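{- Let $G$ be a connected graph of order $n$ and minimum degree $\delta \geq 3$ that contains neither a $4$-cycle nor a $5$-cycle as a subgraph. Then \[ \operatorname{avec}(G) \leq \frac{9}{2} \Big\lceil \frac{n}{\delta^\circ} \Big\rceil + 8, \] where $\delta^\circ = 2\delta^2-5\delta+5$ if $\delta$ is even, and $\delta^\circ = 2\delta^2-5\delta+7$ if $\delta$ is odd.
   Context: All graphs are finite and simple. For a connected graph $G$, the eccentricity $e_G(v)$ of a vertex $v$ is $\max_{w\in V(G)} d_G(v,w)$, where $d_G$ is the shortest-path distance, and the average eccentricity is $\operatorname{avec}(G)=\frac{1}{n}\sum_{v\in V(G)} e_G(v)$ with $n=|V(G)|$. "Containing a $k$-cycle as a subgraph" means containing a cycle of length $k$, not necessarily induced. -}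

module Defs where

open import Data.Nat using (ℕ; zero; suc; _+_; _*_; _∸_; _≤_; _/_)
open import Data.Nat.DivMod using (_mod_)
open import Data.Nat.Properties using (_≟_)
open import Data.Bool using (Bool; true; false; if_then_else_)
open import Data.Fin using (Fin; toℕ)
open import Data.List using (List; map; allFin)
open import Data.Nat.ListAction using (sum)
open import Data.Product using (Σ; _×_; ∃; ∃-syntax)
open import Relation.Binary.PropositionalEquality using (_≡_; _≢_)
open import Relation.Nullary using (does)
open import Function.Definitions using (Injective)

record Graph (n : ℕ) : Set where
  field
    adj   : Fin n → Fin n → Bool
    sym   : ∀ u v → adj u v ≡ adj v u
    irrefl : ∀ v → adj v v ≡ false
open Graph public

Adj : ∀ {n} → Graph n → Fin n → Fin n → Set
Adj G u v = adj G u v ≡ true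

degree : ∀ {n} → Graph n → Fin n → ℕ
degree {n} G v = sum (map (λ w → if adj G v w then 1 else 0) (allFin n))

IsMinDegree : ∀ {n} → Graph n → ℕ → Set
IsMinDegree G δ = (∀ v → δ ≤ degree G v) × (∃[ v ] degree G v ≡ δ)

data Walk {n} (G : Graph n) : Fin n → Fin n → ℕ → Set where
  here  : ∀ {v} → Walk G v v 0
  step  : ∀ {u v w k} → Adj G u v → Walk G v w k → Walk G u w (suc k)

Connected : ∀ {n} → Graph n → Set
Connected G = ∀ u v → ∃[ k ] Walk G u v k

IsDist : ∀ {n} → Graph n → Fin n → Fin n → ℕ → Set
IsDist G u v d = Walk G u v d × (∀ k → Walk G u v k → d ≤ k)

IsEcc : ∀ {n} → Graph n → Fin n → ℕ → Set
IsEcc {n} G v e =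
  (∀ w → ∃[ d ] (IsDist G v w d × d ≤ e)) × (∃[ w ] IsDist G v w e)

next : ∀ {m} → Fin (suc m) → Fin (suc m)
next {m} i = suc (toℕ i) mod suc m

HasCycle : ∀ {n} → Graph n → ℕ → Set
HasCycle G zero = Data.Empty.⊥ where import Data.Empty
HasCycle {n} G (suc m) =
  Σ (Fin (suc m) → Fin n) λ f → Injective _≡_ _≡_ f × (∀ i → Adj G (f i) (f (next i)))

-- δ° = 2δ²-5δ+5 (δ even), 2δ²-5δ+7 (δ odd); written 2δ²+5-5δ (+2) to avoid truncation
-- issues (2δ² ≥ 5δ for δ ≥ 3 anyway)
isEven : ℕ → Bool
isEven zero = true
isEven (suc n) = if isEven n then false else true

δ° : ℕ → ℕ
δ° δ = if isEven δ then 2 * δ * δ + 5 ∸ 5 * δ else 2 * δ * δ + 7 ∸ 5 * δ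

⌈_/suc_⌉ : ℕ → ℕ → ℕ
⌈ m /suc k ⌉ = (m + k) / suc k

Σv : ∀ {n} → (Fin n → ℕ) → ℕ
Σv {n} f = sum (map f (allFin n))

module Submission where

open import Defs renaming (sym to adj-sym; irrefl to adj-irrefl)
open import Data.Bool using (true; false; if_then_else_)
open import Data.Fin as Fin using (Fin; zero; suc)
open import Data.Fin.Patterns
import Data.Fin.Properties as Fin
import Data.List as List using (tabulate)
open import Data.List.Properties using (map-tabulate)
open import Data.Nat
open import Data.Nat.DivMod using (m≡m%n+[m/n]*n; m%n<n)
import Data.Nat.ListAction as List using (sum)
open import Data.Nat.Properties
open import Algebra.Properties.Semiring.Sum +-*-semiring
  using (sum; sum-syntax; ∑-distrib-+; ∑-comm; *-distribˡ-sum; *-distribʳ-sum; sum-cong-≗)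
open import Data.Nat.Tactic.RingSolver using (solve-∀)
open import Data.Product using (_×_; _,_; ∃-syntax; proj₁; proj₂)
open import Data.Sum using (_⊎_; inj₁; inj₂)
open import Data.Vec using (Vec; []; _∷_; lookup)
open import Data.Vec.Relation.Unary.All using ([]; _∷_)
open import Data.Vec.Relation.Unary.AllPairs using ([]; _∷_)
open import Data.Vec.Relation.Unary.Unique.Propositional using (Unique)
open import Data.Vec.Relation.Unary.Unique.Propositional.Properties using (lookup-injective)
open import Function using (_∘_; id)
open import Relation.Binary.PropositionalEquality hiding (J)
open import Relation.Nullary using (¬_; Dec; yes; no; does; contradiction; ¬?; _×-dec_)

-- Call the vertices within distance 2 of an edge its ball. Without 4- and 5-cycles every ball has at least D = δ°
-- vertices. Take greedily edges at pairwise distance at least 5, each at distance exactly 5 from an earlier one, until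
-- every vertex is within distance 5 of a chosen edge. The balls are disjoint, and recording the earlier edge makes the
-- chosen edges the m nodes of a tree with distance ρ, in which ends of edges i and j are at distance at most 6 ρ i j + 1.
-- Let c be a centre of the tree and r its radius. Then every vertex has eccentricity at most 12 r + 11, and at most
-- 12 r + 11 − (6 (r − ρ c i) + 3) if it lies in the ball of the edge i. Every level 1, ..., r − 1 of the tree rooted at c
-- has at least two nodes, hence m ≥ 2 r and the savings add up to at least D (6 r² + 6 r). With n ≥ 2 r D and
-- n ≤ ⌈n / D⌉ D the bound is then a quadratic inequality in r and ⌈n / D⌉.

-- Several linear hypotheses are used at once by adding them up to a single a ≤ b.
linear : ∀ {a b x y} → a ≤ b → x + b ≡ y + a → x ≤ y
linear {a} {b} {x} {y} a≤b eq = +-cancelʳ-≤ b x y (begin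
  x + b      ≡⟨ eq ⟩
  y + a      ≤⟨ +-monoʳ-≤ y a≤b ⟩
  y + b      ∎)
  where open ≤-Reasoning

-- Finite sums and indicator functions.

sum-mono : ∀ {n} {f g : Fin n → ℕ} → (∀ i → f i ≤ g i) → sum f ≤ sum g
sum-mono {zero}  f≤g = z≤n
sum-mono {suc n} f≤g = +-mono-≤ (f≤g zero) (sum-mono (f≤g ∘ suc))

sum-const : ∀ n k → sum {n} (λ _ → k) ≡ n * k
sum-const zero    k = refl
sum-const (suc n) k = cong (k +_) (sum-const n k)

sum-zero : ∀ {n} {f : Fin n → ℕ} → (∀ i → f i ≡ 0) → sum f ≡ 0
sum-zero {zero}  f≡0 = refl
sum-zero {suc n} f≡0 = cong₂ _+_ (f≡0 zero) (sum-zero (f≡0 ∘ suc))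

sum-support : ∀ {n} {f : Fin n → ℕ} j → (∀ i → i ≢ j → f i ≡ 0) → sum f ≡ f j
sum-support {suc n} {f} zero    off =
  trans (cong (f zero +_) (sum-zero (λ i → off (suc i) λ ()))) (+-identityʳ (f zero))
sum-support {suc n} {f} (suc j) off =
  cong₂ _+_ (off zero λ ()) (sum-support j (λ i i≢j → off (suc i) (i≢j ∘ Fin.suc-injective)))

term≤sum : ∀ {n} (f : Fin n → ℕ) i → f i ≤ sum f
term≤sum f zero    = m≤m+n (f zero) _
term≤sum f (suc i) = ≤-trans (term≤sum (f ∘ suc) i) (m≤n+m _ (f zero))

term+term≤sum : ∀ {n} (f : Fin n → ℕ) {i j} → i ≢ j → f i + f j ≤ sum f
term+term≤sum f {zero}  {zero}  i≢j = contradiction refl i≢j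
term+term≤sum f {zero}  {suc j} i≢j = +-monoʳ-≤ (f zero) (term≤sum (f ∘ suc) j)
term+term≤sum f {suc i} {zero}  i≢j =
  subst (_≤ sum f) (+-comm (f zero) (f (suc i))) (+-monoʳ-≤ (f zero) (term≤sum (f ∘ suc) i))
term+term≤sum f {suc i} {suc j} i≢j =
  ≤-trans (term+term≤sum (f ∘ suc) (i≢j ∘ cong suc)) (m≤n+m _ (f zero))

-- Uniqueness statements, such as at most one common neighbour or disjointness of balls, enter the
-- counting through this bound.
sum-≤1 : ∀ {n} (f : Fin n → ℕ) → (∀ i → f i ≤ 1) → (∀ i j → 1 ≤ f i → 1 ≤ f j → i ≡ j) → sum f ≤ 1
sum-≤1 f f≤1 unique with Fin.any? (λ i → 1 ≤? f i)
... | yes (i , 1≤fi) = ≤-trans (≤-reflexive (sum-support i off)) (f≤1 i)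
  where
  off : ∀ j → j ≢ i → f j ≡ 0
  off j j≢i with f j in eq
  ... | zero  = refl
  ... | suc _ = contradiction (unique j i (subst (1 ≤_) (sym eq) (s≤s z≤n)) 1≤fi) j≢i
... | no none = ≤-trans (≤-reflexive (sum-zero (λ i → n<1⇒n≡0 (≰⇒> (λ p → none (i , p)))))) z≤n

Σv≡sum : ∀ {n} (f : Fin n → ℕ) → Σv f ≡ sum f
Σv≡sum f = trans (cong List.sum (map-tabulate id f)) (go f)
  where
  go : ∀ {n} (f : Fin n → ℕ) → List.sum (List.tabulate f) ≡ sum f
  go {zero}  f = refl
  go {suc n} f = cong (f zero +_) (go (f ∘ suc))

-- The diagonal of a symmetric matrix being zero, its entries pair off.
symmetric-sum-even : ∀ {n} (s : Fin n → Fin n → ℕ) → (∀ i j → s i j ≡ s j i) → (∀ i → s i i ≡ 0) →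
                     ∃[ k ] ∑[ i < n ] ∑[ j < n ] s i j ≡ 2 * k
symmetric-sum-even {zero}  s s-sym s-diag = 0 , refl
symmetric-sum-even {suc n} s s-sym s-diag =
  let k , eq = symmetric-sum-even (λ i j → s (suc i) (suc j)) (λ i j → s-sym (suc i) (suc j)) (s-diag ∘ suc)
      row    = sum (λ j → s zero (suc j))
  in row + k , (begin
    (s zero zero + row) + sum (λ i → s (suc i) zero + sum (λ j → s (suc i) (suc j)))
      ≡⟨ cong₂ _+_ (cong (_+ row) (s-diag zero)) (∑-distrib-+ (λ i → s (suc i) zero) _) ⟩
    row + (sum (λ i → s (suc i) zero) + sum (λ i → sum (λ j → s (suc i) (suc j))))
      ≡⟨ cong₂ (λ x y → row + (x + y)) (sum-cong-≗ (λ i → s-sym (suc i) zero)) eq ⟩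
    row + (row + 2 * k)
      ≡⟨ regroup row k ⟩
    2 * (row + k) ∎)
  where
  open ≡-Reasoning
  regroup : ∀ r k → r + (r + 2 * k) ≡ 2 * (r + k)
  regroup = solve-∀

indicator : ∀ {p} {P : Set p} → Dec P → ℕ
indicator P? = if does P? then 1 else 0

indicator-yes : ∀ {p} {P : Set p} (P? : Dec P) → P → indicator P? ≡ 1
indicator-yes (yes _) _ = refl
indicator-yes (no ¬p) p = contradiction p ¬p

indicator-≤1 : ∀ {p} {P : Set p} (P? : Dec P) → indicator P? ≤ 1
indicator-≤1 (yes _) = ≤-refl
indicator-≤1 (no  _) = z≤n

indicator-pos : ∀ {p} {P : Set p} (P? : Dec P) → 1 ≤ indicator P? → P
indicator-pos (yes p) _ = p

indicator-disjoint : ∀ {p q r} {P : Set p} {Q : Set q} {R : Set r} (P? : Dec P) (Q? : Dec Q) (R? : Dec R) →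
                     (P → R) → (Q → R) → (P → ¬ Q) → indicator P? + indicator Q? ≤ indicator R?
indicator-disjoint (no _)  (no _)  R?      P⇒R Q⇒R P⇒¬Q = z≤n
indicator-disjoint (yes p) (yes q) R?      P⇒R Q⇒R P⇒¬Q = contradiction q (P⇒¬Q p)
indicator-disjoint (yes p) (no _)  (yes _) P⇒R Q⇒R P⇒¬Q = ≤-refl
indicator-disjoint (no _)  (yes _) (yes _) P⇒R Q⇒R P⇒¬Q = ≤-refl
indicator-disjoint (yes p) (no _)  (no ¬r) P⇒R Q⇒R P⇒¬Q = contradiction (P⇒R p) ¬r
indicator-disjoint (no _)  (yes q) (no ¬r) P⇒R Q⇒R P⇒¬Q = contradiction (Q⇒R q) ¬r

sum-+₃ : ∀ {n} (f g h : Fin n → ℕ) → sum (λ i → f i + g i + h i) ≡ sum f + sum g + sum h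
sum-+₃ f g h = trans (∑-distrib-+ (λ i → f i + g i) h) (cong (_+ sum h) (∑-distrib-+ f g))

sum-+₄ : ∀ {n} (f g h k : Fin n → ℕ) → sum (λ i → f i + g i + h i + k i) ≡ sum f + sum g + sum h + sum k
sum-+₄ f g h k = trans (∑-distrib-+ (λ i → f i + g i + h i) k) (cong (_+ sum k) (sum-+₃ f g h))

*-pos : ∀ m n → 1 ≤ m * n → 1 ≤ m × 1 ≤ n
*-pos (suc m) zero    pos = contradiction (subst (1 ≤_) (*-zeroʳ m) pos) λ ()
*-pos (suc m) (suc n) pos = s≤s z≤n , s≤s z≤n

-- Centres of trees

-- grow T p hangs a new leaf, numbered zero, on the node p; the old nodes are shifted by suc.
data Tree : ℕ → Set where
  root : Tree 1
  grow : ∀ {m} → Tree m → Fin m → Tree (suc m)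

-- The path metric of the tree: a new leaf is one step beyond its parent, seen from any old node.
ρ : ∀ {m} → Tree m → Fin m → Fin m → ℕ
ρ root       _       _       = 0
ρ (grow T p) zero    zero    = 0
ρ (grow T p) zero    (suc j) = suc (ρ T p j)
ρ (grow T p) (suc i) zero    = suc (ρ T i p)
ρ (grow T p) (suc i) (suc j) = ρ T i j

ρ-refl : ∀ {m} (T : Tree m) i → ρ T i i ≡ 0
ρ-refl root       i       = refl
ρ-refl (grow T p) zero    = refl
ρ-refl (grow T p) (suc i) = ρ-refl T i

ρ-sym : ∀ {m} (T : Tree m) i j → ρ T i j ≡ ρ T j i
ρ-sym root       i       j       = refl
ρ-sym (grow T p) zero    zero    = refl
ρ-sym (grow T p) zero    (suc j) = cong suc (ρ-sym T p j)
ρ-sym (grow T p) (suc i) zero    = cong suc (ρ-sym T i p)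
ρ-sym (grow T p) (suc i) (suc j) = ρ-sym T i j

ρ-triangle : ∀ {m} (T : Tree m) i j k → ρ T i k ≤ ρ T i j + ρ T j k
ρ-triangle root       i       j       k       = z≤n
ρ-triangle (grow T p) zero    j       zero    = z≤n
ρ-triangle (grow T p) zero    zero    (suc k) = ≤-refl
ρ-triangle (grow T p) zero    (suc j) (suc k) = s≤s (ρ-triangle T p j k)
ρ-triangle (grow T p) (suc i) zero    zero    = m≤m+n _ 0
ρ-triangle (grow T p) (suc i) (suc j) zero    =
  ≤-trans (s≤s (ρ-triangle T i j p)) (≤-reflexive (sym (+-suc _ _)))
ρ-triangle (grow T p) (suc i) zero    (suc k) =
  ≤-trans (ρ-triangle T i p k) (+-mono-≤ (n≤1+n _) (n≤1+n _))
ρ-triangle (grow T p) (suc i) (suc j) (suc k) = ρ-triangle T i j k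

-- The node sought lies on the path from `i` to `j`. If `j` is the new leaf, the node is either
-- already on the path to the parent `p` or, when `t = ρ T i p + 1`, the leaf itself.
ρ-between : ∀ {m} (T : Tree m) i j t → t ≤ ρ T i j → ∃[ k ] ρ T i k ≡ t × t + ρ T k j ≡ ρ T i j
ρ-between T i j zero t≤ = i , ρ-refl T i , refl
ρ-between (grow T p) zero (suc j) (suc t) (s≤s t≤) =
  let k , eq , eq′ = ρ-between T p j t t≤ in suc k , cong suc eq , cong suc eq′
ρ-between (grow T p) (suc i) zero (suc t) t≤ with suc t ≤? ρ T i p
... | yes t≤′ =
  let k , eq , eq′ = ρ-between T i p (suc t) t≤′ in suc k , eq , trans (+-suc (suc t) _) (cong suc eq′)
... | no t≰ = let eq = ≤-antisym (≰⇒> t≰) t≤ in zero , eq , trans (+-identityʳ _) (sym eq)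
ρ-between (grow T p) (suc i) (suc j) (suc t) t≤ =
  let k , eq , eq′ = ρ-between T i j (suc t) t≤ in suc k , eq , eq′

tree-node : ∀ {m} → Tree m → Fin m
tree-node root       = zero
tree-node (grow T p) = zero

-- `minimal` says that no node has eccentricity below `radius`. It is stated through a far node
-- because that node is what later arguments compare with.
record Centre {m} (T : Tree m) : Set where
  field
    centre  : Fin m
    radius  : ℕ
    reach   : ∀ i → ρ T centre i ≤ radius
    minimal : ∀ c → ∃[ i ] radius ≤ ρ T c i

-- Descending search: from a crude bound, the sum of all distances from one node, `r` is lowered as
-- long as some node reaches everything within the smaller bound. The first failure yields
-- `minimal`.
find-centre : ∀ {m} (T : Tree m) → Centre T
find-centre T = search (sum (ρ T (tree-node T))) (tree-node T) (term≤sum (ρ T (tree-node T)))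
  where
  search : ∀ r c → (∀ i → ρ T c i ≤ r) → Centre T
  search zero    c reach = record { centre = c ; radius = 0 ; reach = reach ; minimal = λ c′ → c′ , z≤n }
  search (suc r) c reach with Fin.any? (λ c′ → Fin.all? (λ i → ρ T c′ i ≤? r))
  ... | yes (c′ , reach′) = search r c′ reach′
  ... | no  none = record { centre = c ; radius = suc r ; reach = reach ; minimal = far }
    where
    far : ∀ c′ → ∃[ i ] suc r ≤ ρ T c′ i
    far c′ = let i , i≰r = Fin.¬∀⟶∃¬ _ _ (λ i → ρ T c′ i ≤? r) (λ all → none (c′ , all)) in i , ≰⇒> i≰r

module CentreProperties {m} (T : Tree m) (C : Centre T) where
  open Centre C renaming (centre to c; radius to r)

  depth : Fin m → ℕ
  depth = ρ T c

  -- If y were the only node at depth t, its ancestor at depth 1 would have smaller eccentricity than c.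
  two-on-level : ∀ t → 1 ≤ t → t < r → ∃[ i ] ∃[ j ] i ≢ j × depth i ≡ t × depth j ≡ t
  two-on-level t 1≤t t<r with minimal c
  ... | z , r≤z with ρ-between T c z t (≤-trans (<⇒≤ t<r) r≤z)
  ... | y , depth-y , _ with Fin.any? (λ j → ¬? (y Fin.≟ j) ×-dec (depth j ≟ t))
  ... | yes (j , y≢j , depth-j) = y , j , y≢j , depth-y , depth-j
  ... | no  none with ρ-between T c y 1 (subst (1 ≤_) (sym depth-y) 1≤t)
  ... | x , depth-x , x-y with minimal x
  ... | i , r≤i = contradiction r≤i (<⇒≱ closer)
    where
    open ≤-Reasoning
    only-y : ∀ {k} → depth k ≡ t → y ≡ k
    only-y {k} depth-k with y Fin.≟ k
    ... | yes y≡k = y≡k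
    ... | no  y≢k = contradiction (k , y≢k , depth-k) none

    closer : ρ T x i < r
    closer with t ≤? depth i
    -- The path from `c` to such an `i` passes level `t`, hence passes `y`; as `x` is one step
    -- closer to `y` than `c` is, one step is saved.
    ... | yes t≤i with ρ-between T c i t t≤i
    ... | k , depth-k , k-i with only-y depth-k
    ... | refl = begin
      suc (ρ T x i)              ≤⟨ s≤s (ρ-triangle T x y i) ⟩
      suc (ρ T x y) + ρ T y i    ≡⟨ cong (_+ ρ T y i) (trans x-y depth-y) ⟩
      t + ρ T y i                ≡⟨ k-i ⟩
      depth i                    ≤⟨ reach i ⟩
      r                          ∎
    -- Above level `t` the detour through `c` costs at most `1 + depth i ≤ t`, and `t < r`.
    closer | no t≰i = begin
      suc (ρ T x i)              ≤⟨ s≤s (ρ-triangle T x c i) ⟩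
      suc (ρ T x c + depth i)    ≡⟨ cong (λ k → suc (k + depth i)) (trans (ρ-sym T x c) depth-x) ⟩
      suc (suc (depth i))        ≤⟨ s≤s (≰⇒> t≰i) ⟩
      suc t                      ≤⟨ t<r ⟩
      r                          ∎

  within level : ℕ → ℕ
  within u = ∑[ i < m ] indicator (depth i ≤? u)
  level  u = ∑[ i < m ] indicator (depth i ≟ u)

  level-≥2 : ∀ t → 1 ≤ t → t < r → 2 ≤ level t
  level-≥2 t 1≤t t<r with two-on-level t 1≤t t<r
  ... | i , j , i≢j , depth-i , depth-j =
    subst (_≤ level t) (cong₂ _+_ (indicator-yes (depth i ≟ t) depth-i) (indicator-yes (depth j ≟ t) depth-j))
      (term+term≤sum (λ i → indicator (depth i ≟ t)) i≢j)

  within+level-≤ : ∀ {u} (f : Fin m → ℕ) →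
                   (∀ i → indicator (depth i ≤? u) + indicator (depth i ≟ suc u) ≤ f i) →
                   within u + level (suc u) ≤ sum f
  within+level-≤ {u} f ≤f = ≤-trans (≤-reflexive (sym (∑-distrib-+ {m} _ _))) (sum-mono ≤f)

  within-suc : ∀ u i → indicator (depth i ≤? u) + indicator (depth i ≟ suc u) ≤ indicator (depth i ≤? suc u)
  within-suc u i = indicator-disjoint (depth i ≤? u) (depth i ≟ suc u) (depth i ≤? suc u)
    m≤n⇒m≤1+n ≤-reflexive (λ i≤u eq → 1+n≰n (subst (_≤ u) eq i≤u))

  -- The centre itself, and two nodes on each of the levels 1 to `u`.
  within-≥ : ∀ u → u < r → 2 * u + 1 ≤ within u
  within-≥ zero u<r = subst (_≤ within 0) (indicator-yes (depth c ≤? 0) (≤-reflexive (ρ-refl T c)))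
    (term≤sum (λ i → indicator (depth i ≤? 0)) c)
  within-≥ (suc u) u<r = begin
    2 * suc u + 1            ≡⟨ regroup u ⟩
    2 * u + 1 + 2            ≤⟨ +-mono-≤ (within-≥ u (<⇒≤ u<r)) (level-≥2 (suc u) (s≤s z≤n) u<r) ⟩
    within u + level (suc u) ≤⟨ within+level-≤ _ (within-suc u) ⟩
    within (suc u)           ∎
    where
    open ≤-Reasoning
    regroup : ∀ u → 2 * suc u + 1 ≡ 2 * u + 1 + 2
    regroup = solve-∀

  -- `within-≥` gives `2 * r − 1` nodes above the last level, and `minimal` applied to the centre
  -- gives one more at depth `r`.
  2*radius≤order : 2 * r ≤ m
  2*radius≤order = go r refl
    where
    open ≤-Reasoning
    regroup : ∀ u → 2 * suc u ≡ 2 * u + 1 + 1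
    regroup = solve-∀

    go : ∀ r′ → r ≡ r′ → 2 * r′ ≤ m
    go zero    _  = z≤n
    go (suc u) eq with minimal c
    ... | z , r≤z = begin
      2 * suc u                ≡⟨ regroup u ⟩
      2 * u + 1 + 1            ≤⟨ +-mono-≤ (within-≥ u (≤-reflexive (sym eq))) 1≤level ⟩
      within u + level (suc u) ≤⟨ within+level-≤ _ (λ i → ≤-trans (within-suc u i) (indicator-≤1 (depth i ≤? suc u))) ⟩
      sum (λ (_ : Fin m) → 1)  ≡⟨ trans (sum-const m 1) (*-identityʳ m) ⟩
      m                        ∎
      where
      depth-z : depth z ≡ suc u
      depth-z = trans (≤-antisym (reach z) r≤z) eq

      1≤level : 1 ≤ level (suc u)
      1≤level = subst (_≤ level (suc u)) (indicator-yes (depth z ≟ suc u) depth-z)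
        (term≤sum (λ i → indicator (depth i ≟ suc u)) z)

  -- Raising `u` by one adds 1 to the term of every node within depth `u`, and there are at least
  -- `2 * u + 1` of these, the difference of consecutive squares.
  height-sum-≥ : ∀ u → u ≤ r → u * u ≤ ∑[ i < m ] (u ∸ depth i)
  height-sum-≥ zero    _   = z≤n
  height-sum-≥ (suc u) u<r = begin
    suc u * suc u                                                    ≡⟨ regroup u ⟩
    u * u + (2 * u + 1)                                              ≤⟨ +-mono-≤ (height-sum-≥ u (<⇒≤ u<r)) (within-≥ u u<r) ⟩
    sum (λ i → u ∸ depth i) + within u                               ≡⟨ ∑-distrib-+ {m} _ _ ⟨
    sum (λ i → (u ∸ depth i) + indicator (depth i ≤? u))             ≤⟨ sum-mono (λ i → increment (depth i) (depth i ≤? u)) ⟩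
    sum (λ i → suc u ∸ depth i)                                      ∎
    where
    open ≤-Reasoning
    regroup : ∀ u → suc u * suc u ≡ u * u + (2 * u + 1)
    regroup = solve-∀

    increment : ∀ k (k≤u? : Dec (k ≤ u)) → (u ∸ k) + indicator k≤u? ≤ suc u ∸ k
    increment k (yes k≤u) = ≤-reflexive (trans (+-comm (u ∸ k) 1) (sym (+-∸-assoc 1 k≤u)))
    increment k (no  k≰u) = ≤-trans (≤-reflexive (trans (+-identityʳ _) (m≤n⇒m∸n≡0 (<⇒≤ (≰⇒> k≰u))))) z≤n

  -- The factor 6 is the cost of a tree step. The 3 is 5 - 2: a vertex of a ball is within 2 of its
  -- edge, whereas an arbitrary vertex is only known to be within 5 of some edge.
  saving : Fin m → ℕ
  saving i = 6 * (r ∸ depth i) + 3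

  -- The heights contribute `6 * r * r`; the constants contribute `3 * m`, which is at least
  -- `6 * r`.
  saving-sum-≥ : 6 * r * r + 6 * r ≤ sum saving
  saving-sum-≥ = begin
    6 * r * r + 6 * r                                    ≡⟨ regroup r ⟩
    6 * (r * r) + 2 * r * 3                              ≤⟨ +-mono-≤ (*-monoʳ-≤ 6 (height-sum-≥ r ≤-refl)) (*-monoˡ-≤ 3 2*radius≤order) ⟩
    6 * sum (λ i → r ∸ depth i) + m * 3                  ≡⟨ cong₂ _+_ (*-distribˡ-sum {m} 6 _) (sym (sum-const m 3)) ⟩
    sum (λ i → 6 * (r ∸ depth i)) + sum {m} (λ _ → 3)    ≡⟨ ∑-distrib-+ {m} _ _ ⟨
    sum saving                                           ∎
    where
    open ≤-Reasoning
    regroup : ∀ r → 6 * r * r + 6 * r ≡ 6 * (r * r) + 2 * r * 3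
    regroup = solve-∀

-- The ball around an edge

isEven-2* : ∀ k → isEven (2 * k) ≡ true
isEven-2* zero = refl
isEven-2* (suc k) rewrite +-suc k (k + 0) | isEven-2* k = refl

oddness : ℕ → ℕ
oddness e = if isEven e then 0 else 1

oddness-≤1 : ∀ e → oddness e ≤ 1
oddness-≤1 e with isEven e
... | true  = z≤n
... | false = ≤-refl

-- With `e = δ − 2` the truncated subtraction disappears; since `e` has the parity of `δ`, the two
-- cases differ only in the last term.
δ°-value : ∀ e → δ° (2 + e) ≡ 2 * e * e + 3 * e + 3 + 2 * oddness e
δ°-value e with isEven e
... | true  = trans (cong (_∸ 5 * (2 + e)) (expand e)) (m+n∸m≡n (5 * (2 + e)) _)
  where
  expand : ∀ e → 2 * (2 + e) * (2 + e) + 5 ≡ 5 * (2 + e) + (2 * e * e + 3 * e + 3 + 0)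
  expand = solve-∀
... | false = trans (cong (_∸ 5 * (2 + e)) (expand e)) (m+n∸m≡n (5 * (2 + e)) _)
  where
  expand : ∀ e → 2 * (2 + e) * (2 + e) + 7 ≡ 5 * (2 + e) + (2 * e * e + 3 * e + 3 + 2)
  expand = solve-∀

δ°-pos : ∀ e → 1 ≤ δ° (2 + e)
δ°-pos e = subst (1 ≤_) (sym (trans (δ°-value e) (rotate e (oddness e)))) (s≤s z≤n)
  where
  rotate : ∀ e o → 2 * e * e + 3 * e + 3 + 2 * o ≡ 1 + (2 + 2 * e * e + 3 * e + 2 * o)
  rotate = solve-∀

-- For odd `e` the even number `i` cannot equal `e`, so the inequality is strict.
even<odd : ∀ {i e} k → i ≡ 2 * k → i ≤ e → i + oddness e ≤ e
even<odd {i} {e} k i≡2k i≤e with isEven e in eq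
... | true  = ≤-trans (≤-reflexive (+-identityʳ i)) i≤e
... | false = subst (_≤ e) (+-comm 1 i) (≤∧≢⇒< i≤e λ { refl →
  contradiction (trans (sym eq) (trans (cong isEven i≡2k) (isEven-2* k))) λ () })

module _ {n} (G : Graph n) where

  adj⇒≢ : ∀ {u v} → Adj G u v → u ≢ v
  adj⇒≢ {u} uv refl = contradiction (trans (sym uv) (adj-irrefl G u)) λ ()

  flip-adj : ∀ {u v} → Adj G u v → Adj G v u
  flip-adj {u} {v} uv = trans (adj-sym G v u) uv

  cycle : ∀ {m} (vs : Vec (Fin n) (suc m)) → Unique vs →
          (∀ i → Adj G (lookup vs i) (lookup vs (next i))) → HasCycle G (suc m)
  cycle vs unique edges = lookup vs , (λ {i} {j} → lookup-injective unique i j) , edges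

  -- Only the diagonals have to be separated by hypothesis: consecutive vertices differ because they
  -- are adjacent. The same holds for `five-cycle`.
  four-cycle : ∀ {v₀ v₁ v₂ v₃} → v₀ ≢ v₂ → v₁ ≢ v₃ →
               Adj G v₀ v₁ → Adj G v₁ v₂ → Adj G v₂ v₃ → Adj G v₃ v₀ → HasCycle G 4
  four-cycle {v₀} {v₁} {v₂} {v₃} ≢₀₂ ≢₁₃ e₀₁ e₁₂ e₂₃ e₃₀ = cycle (v₀ ∷ v₁ ∷ v₂ ∷ v₃ ∷ [])
    ((adj⇒≢ e₀₁ ∷ ≢₀₂ ∷ ≢-sym (adj⇒≢ e₃₀) ∷ []) ∷ (adj⇒≢ e₁₂ ∷ ≢₁₃ ∷ []) ∷ (adj⇒≢ e₂₃ ∷ []) ∷ [] ∷ [])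
    λ { 0F → e₀₁ ; 1F → e₁₂ ; 2F → e₂₃ ; 3F → e₃₀ }

  five-cycle : ∀ {v₀ v₁ v₂ v₃ v₄} → v₀ ≢ v₂ → v₀ ≢ v₃ → v₁ ≢ v₃ → v₁ ≢ v₄ → v₂ ≢ v₄ →
               Adj G v₀ v₁ → Adj G v₁ v₂ → Adj G v₂ v₃ → Adj G v₃ v₄ → Adj G v₄ v₀ → HasCycle G 5
  five-cycle {v₀} {v₁} {v₂} {v₃} {v₄} ≢₀₂ ≢₀₃ ≢₁₃ ≢₁₄ ≢₂₄ e₀₁ e₁₂ e₂₃ e₃₄ e₄₀ = cycle (v₀ ∷ v₁ ∷ v₂ ∷ v₃ ∷ v₄ ∷ [])
    ((adj⇒≢ e₀₁ ∷ ≢₀₂ ∷ ≢₀₃ ∷ ≢-sym (adj⇒≢ e₄₀) ∷ []) ∷ (adj⇒≢ e₁₂ ∷ ≢₁₃ ∷ ≢₁₄ ∷ []) ∷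
     (adj⇒≢ e₂₃ ∷ ≢₂₄ ∷ []) ∷ (adj⇒≢ e₃₄ ∷ []) ∷ [] ∷ [])
    λ { 0F → e₀₁ ; 1F → e₁₂ ; 2F → e₂₃ ; 3F → e₃₄ ; 4F → e₄₀ }

  A : Fin n → Fin n → ℕ
  A u v = if adj G u v then 1 else 0

  A-≤1 : ∀ u v → A u v ≤ 1
  A-≤1 u v with adj G u v
  ... | true  = ≤-refl
  ... | false = z≤n

  A-sym : ∀ u v → A u v ≡ A v u
  A-sym u v = cong (if_then 1 else 0) (adj-sym G u v)

  A-irrefl : ∀ v → A v v ≡ 0
  A-irrefl v = cong (if_then 1 else 0) (adj-irrefl G v)

  A-adj : ∀ {u v} → 1 ≤ A u v → Adj G u v
  A-adj {u} {v} pos with adj G u v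
  ... | true = refl

  A-nonadj : ∀ {u v} → ¬ Adj G u v → A u v ≡ 0
  A-nonadj {u} {v} ¬uv with adj G u v
  ... | true  = contradiction refl ¬uv
  ... | false = refl

  degree≡sum : ∀ v → degree G v ≡ ∑[ w < n ] A v w
  degree≡sum v = Σv≡sum (A v)

  module _ (no-C4 : ¬ HasCycle G 4) where

    -- Otherwise `x u y v` is a 4-cycle. Nearly every use of `no-C4` goes through this form.
    common-unique : ∀ {x y u v} → x ≢ y → Adj G x u → Adj G x v → Adj G y u → Adj G y v → u ≡ v
    common-unique {x} {y} {u} {v} x≢y xu xv yu yv with u Fin.≟ v
    ... | yes u≡v = u≡v
    ... | no  u≢v = contradiction (four-cycle x≢y u≢v xu (flip-adj yu) yv (flip-adj xv)) no-C4

    -- Applied to either end `c` of the edge, with `α` the indicator of those neighbours of `c` that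
    -- are neither the other end nor adjacent to it.
    module Side (c : Fin n) (α : Fin n → ℕ) (α-≤1 : ∀ v → α v ≤ 1) (α-adj : ∀ v → 1 ≤ α v → Adj G c v) where

      inner : ℕ
      inner = ∑[ x < n ] ∑[ v < n ] (α x * A x v * α v)

      inner-even : ∃[ k ] inner ≡ 2 * k
      inner-even = symmetric-sum-even (λ x v → α x * A x v * α v)
        (λ x v → trans (cong (λ t → α x * t * α v) (A-sym x v)) (swap (α x) (A v x) (α v)))
        (λ v → trans (cong (λ t → α v * t * α v) (A-irrefl v)) (cong (_* α v) (*-zeroʳ (α v))))
        where
        swap : ∀ a b c → a * b * c ≡ c * b * a
        swap = solve-∀

      -- Two neighbours v, w of x on the same side would make x and c opposite corners of a 4-cycle.
      inner-≤ : inner ≤ sum α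
      inner-≤ = sum-mono row
        where
        row : ∀ x → ∑[ v < n ] (α x * A x v * α v) ≤ α x
        row x with α x in eq
        ... | zero  = ≤-reflexive (sum-zero {n} (λ v → refl))
        ... | suc k = ≤-trans (sum-≤1 _ bound unique) (s≤s z≤n)
          where
          cx : Adj G c x
          cx = α-adj x (subst (1 ≤_) (sym eq) (s≤s z≤n))

          bound : ∀ v → suc k * A x v * α v ≤ 1
          bound v = *-mono-≤ (*-mono-≤ (subst (_≤ 1) eq (α-≤1 x)) (A-≤1 x v)) (α-≤1 v)

          unique : ∀ v w → 1 ≤ suc k * A x v * α v → 1 ≤ suc k * A x w * α w → v ≡ w
          unique v w pv pw =
            let pv₁ , pv₂ = *-pos (suc k * A x v) (α v) pv
                pw₁ , pw₂ = *-pos (suc k * A x w) (α w) pw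
            in common-unique (adj⇒≢ cx) (α-adj v pv₂) (α-adj w pw₂)
                 (A-adj (proj₂ (*-pos (suc k) _ pv₁))) (A-adj (proj₂ (*-pos (suc k) _ pw₁)))

      -- The right side is the least possible degree sum of the side, so `(1 + e) * (1 + e)` bounds
      -- from below what remains of it after removing the edges within the side. This version serves
      -- an edge in no triangle, `inner-bound` an edge in one.
      inner-bound-large : ∀ {e} → 1 + e ≤ sum α → inner + (1 + e) * (1 + e) ≤ (2 + e) * sum α
      inner-bound-large {e} e<p = begin
        inner + (1 + e) * (1 + e)    ≤⟨ +-mono-≤ inner-≤ (*-monoʳ-≤ (1 + e) e<p) ⟩
        (2 + e) * sum α              ∎
        where open ≤-Reasoning

      -- inner counts every edge within the side twice: this is where the parity of δ enters.
      inner-bound : ∀ {e} → e ≤ sum α → inner + (1 + e) * e + oddness e ≤ (2 + e) * sum α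
      inner-bound {e} e≤p with m≤n⇒m<n∨m≡n e≤p
      ... | inj₁ e<p = begin
        inner + (1 + e) * e + oddness e  ≤⟨ +-monoʳ-≤ (inner + (1 + e) * e) (oddness-≤1 e) ⟩
        inner + (1 + e) * e + 1          ≤⟨ m≤m+n _ e ⟩
        inner + (1 + e) * e + 1 + e      ≡⟨ regroup inner e ⟩
        inner + (1 + e) * (1 + e)        ≤⟨ inner-bound-large e<p ⟩
        (2 + e) * sum α                  ∎
        where
        open ≤-Reasoning
        regroup : ∀ i e → i + (1 + e) * e + 1 + e ≡ i + (1 + e) * (1 + e)
        regroup = solve-∀
      -- The tight case `sum α = e`: the even number `inner` cannot reach an odd `e`.
      ... | inj₂ refl = begin
        inner + (1 + e) * e + oddness e    ≡⟨ regroup inner ((1 + e) * e) (oddness e) ⟩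
        inner + oddness e + (1 + e) * e    ≤⟨ +-monoˡ-≤ _ (even<odd {e = e} (proj₁ inner-even) (proj₂ inner-even) inner-≤) ⟩
        (2 + e) * e                        ∎
        where
        open ≤-Reasoning
        regroup : ∀ i j k → i + j + k ≡ i + k + j
        regroup = solve-∀

    -- `e` stands for `δ − 2`. Since `sum ball` is only bounded from below, it suffices that `ball`
    -- is positive within distance 2 of the edge.
    module EdgeBall (no-C5 : ¬ HasCycle G 5) (e : ℕ) (1≤e : 1 ≤ e) (min-degree : ∀ v → 2 + e ≤ degree G v)
                    (a b : Fin n) (ab : Adj G a b) (ball : Fin n → ℕ)
                    (ball-pos : ∀ v k → Walk G a v k ⊎ Walk G b v k → k ≤ 2 → 1 ≤ ball v) where

      -- The negative facts make the zones disjoint and are kept for the case distinctions. `outer`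
      -- holds everything outside the closed neighbourhoods of `a` and `b`, at whatever distance.
      data Zone (v : Fin n) : Set where
        at-a   : v ≡ a → Zone v
        at-b   : v ≡ b → Zone v
        only-a : Adj G a v → ¬ Adj G b v → v ≢ b → Zone v
        only-b : ¬ Adj G a v → Adj G b v → v ≢ a → Zone v
        common : Adj G a v → Adj G b v → Zone v
        outer  : ¬ Adj G a v → ¬ Adj G b v → v ≢ a → v ≢ b → Zone v

      zone : ∀ v → Zone v
      zone v with v Fin.≟ a | v Fin.≟ b | adj G a v in eqa | adj G b v in eqb
      ... | yes v≡a | _       | _     | _     = at-a v≡a
      ... | no _    | yes v≡b | _     | _     = at-b v≡b
      ... | no v≢a  | no v≢b  | true  | true  = common eqa eqb
      ... | no v≢a  | no v≢b  | true  | false = only-a eqa (λ bv → contradiction (trans (sym eqb) bv) λ ()) v≢b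
      ... | no v≢a  | no v≢b  | false | true  = only-b (λ av → contradiction (trans (sym eqa) av) λ ()) eqb v≢a
      ... | no v≢a  | no v≢b  | false | false = outer (λ av → contradiction (trans (sym eqa) av) λ ())
                                                      (λ bv → contradiction (trans (sym eqb) bv) λ ()) v≢a v≢b

      -- The bracketed indicators take a zone instead of a vertex, so that inequalities between them
      -- can be checked by matching on an arbitrary zone. `[ℓ]` is the first neighbourhood of the
      -- edge.
      [a] [b] [α] [β] [γ] [ω] [ℓ] : ∀ {v} → Zone v → ℕ
      [a] (at-a _) = 1
      [a] _ = 0
      [b] (at-b _) = 1
      [b] _ = 0
      [α] (only-a _ _ _) = 1
      [α] _ = 0
      [β] (only-b _ _ _) = 1
      [β] _ = 0
      [γ] (common _ _) = 1
      [γ] _ = 0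
      [ω] (outer _ _ _ _) = 1
      [ω] _ = 0
      [ℓ] z = [α] z + [β] z + [γ] z

      α β γ ω ℓ : Fin n → ℕ
      α v = [α] (zone v)
      β v = [β] (zone v)
      γ v = [γ] (zone v)
      ω v = [ω] (zone v)
      ℓ v = [ℓ] (zone v)

      partition : ∀ {v} (z : Zone v) → [a] z + [b] z + [ℓ] z + [ω] z ≡ 1
      partition (at-a _)        = refl
      partition (at-b _)        = refl
      partition (only-a _ _ _)  = refl
      partition (only-b _ _ _)  = refl
      partition (common _ _)    = refl
      partition (outer _ _ _ _) = refl

      [α]-≤1 : ∀ {v} (z : Zone v) → [α] z ≤ 1
      [α]-≤1 (at-a _)        = z≤n
      [α]-≤1 (at-b _)        = z≤n
      [α]-≤1 (only-a _ _ _)  = ≤-refl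
      [α]-≤1 (only-b _ _ _)  = z≤n
      [α]-≤1 (common _ _)    = z≤n
      [α]-≤1 (outer _ _ _ _) = z≤n

      [β]-≤1 : ∀ {v} (z : Zone v) → [β] z ≤ 1
      [β]-≤1 (at-a _)        = z≤n
      [β]-≤1 (at-b _)        = z≤n
      [β]-≤1 (only-a _ _ _)  = z≤n
      [β]-≤1 (only-b _ _ _)  = ≤-refl
      [β]-≤1 (common _ _)    = z≤n
      [β]-≤1 (outer _ _ _ _) = z≤n

      [γ]-≤1 : ∀ {v} (z : Zone v) → [γ] z ≤ 1
      [γ]-≤1 (at-a _)        = z≤n
      [γ]-≤1 (at-b _)        = z≤n
      [γ]-≤1 (only-a _ _ _)  = z≤n
      [γ]-≤1 (only-b _ _ _)  = z≤n
      [γ]-≤1 (common _ _)    = ≤-refl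
      [γ]-≤1 (outer _ _ _ _) = z≤n

      [ℓ]-≤1 : ∀ {v} (z : Zone v) → [ℓ] z ≤ 1
      [ℓ]-≤1 z = ≤-trans (≤-trans (m≤n+m ([ℓ] z) ([a] z + [b] z)) (m≤m+n _ ([ω] z))) (≤-reflexive (partition z))

      [α]-adj : ∀ {v} (z : Zone v) → 1 ≤ [α] z → Adj G a v
      [α]-adj (only-a av _ _) _ = av

      [β]-adj : ∀ {v} (z : Zone v) → 1 ≤ [β] z → Adj G b v
      [β]-adj (only-b _ bv _) _ = bv

      [γ]-adj : ∀ {v} (z : Zone v) → 1 ≤ [γ] z → Adj G a v × Adj G b v
      [γ]-adj (common av bv) _ = av , bv

      module A-side = Side a α (λ v → [α]-≤1 (zone v)) (λ v → [α]-adj (zone v))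
      module B-side = Side b β (λ v → [β]-≤1 (zone v)) (λ v → [β]-adj (zone v))

      p q c : ℕ
      p = sum α
      q = sum β
      c = sum γ

      -- Two triangles on `ab` would form a 4-cycle with `ab` as a diagonal.
      c≤1 : c ≤ 1
      c≤1 = sum-≤1 γ (λ v → [γ]-≤1 (zone v)) λ v w pv pw →
        let av , bv = [γ]-adj (zone v) pv
            aw , bw = [γ]-adj (zone w) pw
        in common-unique (adj⇒≢ ab) av aw bv bw

      [a]-off : ∀ {v} (z : Zone v) → v ≢ a → [a] z ≡ 0
      [a]-off (at-a v≡a)      v≢a = contradiction v≡a v≢a
      [a]-off (at-b _)        _   = refl
      [a]-off (only-a _ _ _)  _   = refl
      [a]-off (only-b _ _ _)  _   = refl
      [a]-off (common _ _)    _   = refl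
      [a]-off (outer _ _ _ _) _   = refl

      [b]-off : ∀ {v} (z : Zone v) → v ≢ b → [b] z ≡ 0
      [b]-off (at-a _)        _   = refl
      [b]-off (at-b v≡b)      v≢b = contradiction v≡b v≢b
      [b]-off (only-a _ _ _)  _   = refl
      [b]-off (only-b _ _ _)  _   = refl
      [b]-off (common _ _)    _   = refl
      [b]-off (outer _ _ _ _) _   = refl

      [a]-on : (z : Zone a) → [a] z ≡ 1
      [a]-on (at-a _)         = refl
      [a]-on (at-b a≡b)       = contradiction a≡b (adj⇒≢ ab)
      [a]-on (only-a aa _ _)  = contradiction refl (adj⇒≢ aa)
      [a]-on (only-b _ _ a≢a) = contradiction refl a≢a
      [a]-on (common aa _)    = contradiction refl (adj⇒≢ aa)
      [a]-on (outer _ _ a≢a _) = contradiction refl a≢a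

      [b]-on : (z : Zone b) → [b] z ≡ 1
      [b]-on (at-a b≡a)        = contradiction (sym b≡a) (adj⇒≢ ab)
      [b]-on (at-b _)          = refl
      [b]-on (only-a _ _ b≢b)  = contradiction refl b≢b
      [b]-on (only-b _ bb _)   = contradiction refl (adj⇒≢ bb)
      [b]-on (common _ bb)     = contradiction refl (adj⇒≢ bb)
      [b]-on (outer _ _ _ b≢b) = contradiction refl b≢b

      sum-*[a] : ∀ (f : Fin n → ℕ) → ∑[ v < n ] (f v * [a] (zone v)) ≡ f a
      sum-*[a] f = trans
        (sum-support a (λ v v≢a → trans (cong (f v *_) ([a]-off (zone v) v≢a)) (*-zeroʳ (f v))))
        (trans (cong (f a *_) ([a]-on (zone a))) (*-identityʳ (f a)))

      sum-*[b] : ∀ (f : Fin n → ℕ) → ∑[ v < n ] (f v * [b] (zone v)) ≡ f b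
      sum-*[b] f = trans
        (sum-support b (λ v v≢b → trans (cong (f v *_) ([b]-off (zone v) v≢b)) (*-zeroʳ (f v))))
        (trans (cong (f b *_) ([b]-on (zone b))) (*-identityʳ (f b)))

      sum-[a] : ∑[ v < n ] [a] (zone v) ≡ 1
      sum-[a] = trans (sum-support a (λ v → [a]-off (zone v))) ([a]-on (zone a))

      sum-[b] : ∑[ v < n ] [b] (zone v) ≡ 1
      sum-[b] = trans (sum-support b (λ v → [b]-off (zone v))) ([b]-on (zone b))

      -- One neighbour of `a` is `b`; the others are counted by `p` or `c`.
      degree-a : 1 + e ≤ p + c
      degree-a = s≤s⁻¹ (begin
        2 + e                                               ≤⟨ min-degree a ⟩
        degree G a                                          ≡⟨ degree≡sum a ⟩
        sum (A a)                                           ≤⟨ sum-mono (λ v → split (zone v)) ⟩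
        sum (λ v → [b] (zone v) + α v + γ v)                ≡⟨ sum-+₃ _ α γ ⟩
        sum (λ v → [b] (zone v)) + p + c                    ≡⟨ cong (λ t → t + p + c) sum-[b] ⟩
        1 + p + c                                           ∎)
        where
        open ≤-Reasoning
        split : ∀ {v} (z : Zone v) → A a v ≤ [b] z + [α] z + [γ] z
        split (at-a refl)      = ≤-reflexive (A-irrefl a)
        split (at-b _)         = A-≤1 a _
        split (only-a _ _ _)   = A-≤1 a _
        split (only-b ¬av _ _) = ≤-reflexive (A-nonadj ¬av)
        split (common _ _)     = A-≤1 a _
        split (outer ¬av _ _ _) = ≤-reflexive (A-nonadj ¬av)

      degree-b : 1 + e ≤ q + c
      degree-b = s≤s⁻¹ (begin
        2 + e                                               ≤⟨ min-degree b ⟩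
        degree G b                                          ≡⟨ degree≡sum b ⟩
        sum (A b)                                           ≤⟨ sum-mono (λ v → split (zone v)) ⟩
        sum (λ v → [a] (zone v) + β v + γ v)                ≡⟨ sum-+₃ _ β γ ⟩
        sum (λ v → [a] (zone v)) + q + c                    ≡⟨ cong (λ t → t + q + c) sum-[a] ⟩
        1 + q + c                                           ∎)
        where
        open ≤-Reasoning
        split : ∀ {v} (z : Zone v) → A b v ≤ [a] z + [β] z + [γ] z
        split (at-a _)          = A-≤1 b _
        split (at-b refl)       = ≤-reflexive (A-irrefl b)
        split (only-a _ ¬bv _)  = ≤-reflexive (A-nonadj ¬bv)
        split (only-b _ _ _)    = A-≤1 b _
        split (common _ _)      = A-≤1 b _
        split (outer _ ¬bv _ _) = ≤-reflexive (A-nonadj ¬bv)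

      -- Otherwise a b v x is a 4-cycle.
      no-cross : ∀ {x v} → Adj G a x → x ≢ b → Adj G b v → v ≢ a → ¬ Adj G x v
      no-cross ax x≢b bv v≢a xv =
        v≢a (sym (common-unique (≢-sym x≢b) (flip-adj ab) bv (flip-adj ax) xv))

      -- The adjacency matrix restricted to rows in the first neighbourhood: its row sums there are
      -- degrees.
      f : Fin n → Fin n → ℕ
      f x v = ℓ x * A x v

      to-centres : ∀ x → f x a + f x b ≤ α x + β x + 2 * γ x
      to-centres x = go (zone x)
        where
        go : (z : Zone x) → [ℓ] z * A x a + [ℓ] z * A x b ≤ [α] z + [β] z + 2 * [γ] z
        go (at-a _)         = z≤n
        go (at-b _)         = z≤n
        go (only-a _ ¬bx _) = +-mono-≤ (*-mono-≤ (≤-refl {1}) (A-≤1 x a)) (≤-reflexive (cong (1 *_) (A-nonadj (¬bx ∘ flip-adj))))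
        go (only-b ¬ax _ _) = +-mono-≤ (≤-reflexive (cong (1 *_) (A-nonadj (¬ax ∘ flip-adj)))) (*-mono-≤ (≤-refl {1}) (A-≤1 x b))
        go (common _ _)     = +-mono-≤ (*-mono-≤ (≤-refl {1}) (A-≤1 x a)) (*-mono-≤ (≤-refl {1}) (A-≤1 x b))
        go (outer _ _ _ _)  = z≤n

      -- Edges within the first neighbourhood stay among the private neighbours of a single end: by
      -- `no-cross` none joins the two sides and none joins a common neighbour to the rest.
      inside : ∀ x v → f x v * ℓ v ≤ α x * A x v * α v + β x * A x v * β v
      inside x v = go (zone x) (zone v)
        where
        off : ∀ {t} → 1 * A x v * 0 ≤ t
        off = ≤-trans (≤-reflexive (*-zeroʳ (1 * A x v))) z≤n

        cut : ∀ {t} → ¬ Adj G x v → 1 * A x v * 1 ≤ t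
        cut ¬xv rewrite A-nonadj ¬xv = z≤n

        go : (z : Zone x) (w : Zone v) → [ℓ] z * A x v * [ℓ] w ≤ [α] z * A x v * [α] w + [β] z * A x v * [β] w
        go (at-a _)           w                  = z≤n
        go (at-b _)           w                  = z≤n
        go (outer _ _ _ _)    w                  = z≤n
        go (only-a _ _ _)     (at-a _)           = off
        go (only-a _ _ _)     (at-b _)           = off
        go (only-a _ _ _)     (outer _ _ _ _)    = off
        go (only-a _ _ _)     (only-a _ _ _)     = m≤m+n _ _
        go (only-a ax _ x≢b)  (only-b _ bv v≢a)  = cut (no-cross ax x≢b bv v≢a)
        go (only-a ax _ x≢b)  (common av bv)     = cut (no-cross ax x≢b bv (≢-sym (adj⇒≢ av)))
        go (only-b _ _ _)     (at-a _)           = off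
        go (only-b _ _ _)     (at-b _)           = off
        go (only-b _ _ _)     (outer _ _ _ _)    = off
        go (only-b _ bx x≢a)  (only-a av _ v≢b)  = cut (no-cross av v≢b bx x≢a ∘ flip-adj)
        go (only-b _ _ _)     (only-b _ _ _)     = ≤-refl
        go (only-b _ bx x≢a)  (common av bv)     = cut (no-cross av (≢-sym (adj⇒≢ bv)) bx x≢a ∘ flip-adj)
        go (common _ _)       (at-a _)           = off
        go (common _ _)       (at-b _)           = off
        go (common _ _)       (outer _ _ _ _)    = off
        go (common ax bx)     (only-a av _ v≢b)  = cut (no-cross av v≢b bx (≢-sym (adj⇒≢ ax)) ∘ flip-adj)
        go (common ax bx)     (only-b _ bv v≢a)  = cut (no-cross ax (≢-sym (adj⇒≢ bx)) bv v≢a)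
        go (common ax bx)     (common av bv)     = cut (no-cross ax (≢-sym (adj⇒≢ bx)) bv (≢-sym (adj⇒≢ av)))

      [ℓ]-pos : ∀ {x} (z : Zone x) → 1 ≤ [ℓ] z → (x ≢ a × x ≢ b) × (Adj G a x ⊎ Adj G b x)
      [ℓ]-pos (only-a ax _ x≢b) _ = (≢-sym (adj⇒≢ ax) , x≢b) , inj₁ ax
      [ℓ]-pos (only-b _ bx x≢a) _ = (x≢a , ≢-sym (adj⇒≢ bx)) , inj₂ bx
      [ℓ]-pos (common ax bx)    _ = (≢-sym (adj⇒≢ ax) , ≢-sym (adj⇒≢ bx)) , inj₁ ax

      f-pos : ∀ {x v} → 1 ≤ f x v → ((x ≢ a × x ≢ b) × (Adj G a x ⊎ Adj G b x)) × Adj G x v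
      f-pos {x} {v} pos = let ℓ-pos , A-pos = *-pos (ℓ x) (A x v) pos in [ℓ]-pos (zone x) ℓ-pos , A-adj A-pos

      -- Two such neighbours would close a 4-cycle through a or through b, or a 5-cycle through the edge ab.
      inner-neighbour-unique : ∀ {v} → v ≢ a → v ≢ b → ∀ x y → 1 ≤ f x v → 1 ≤ f y v → x ≡ y
      inner-neighbour-unique {v} v≢a v≢b x y px py with f-pos {x} {v} px | f-pos {y} {v} py
      ... | (_ , inj₁ ax) , xv | (_ , inj₁ ay) , yv =
        common-unique (≢-sym v≢a) ax ay (flip-adj xv) (flip-adj yv)
      ... | (_ , inj₂ bx) , xv | (_ , inj₂ by) , yv =
        common-unique (≢-sym v≢b) bx by (flip-adj xv) (flip-adj yv)
      ... | ((x≢a , x≢b) , inj₁ ax) , xv | ((y≢a , y≢b) , inj₂ by) , yv with x Fin.≟ y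
      ...   | yes x≡y = x≡y
      ...   | no  x≢y = contradiction
        (five-cycle (≢-sym v≢a) (≢-sym y≢a) x≢y x≢b v≢b ax xv (flip-adj yv) (flip-adj by) (flip-adj ab)) no-C5
      inner-neighbour-unique {v} v≢a v≢b x y px py
          | ((x≢a , x≢b) , inj₂ bx) , xv | ((y≢a , y≢b) , inj₁ ay) , yv with x Fin.≟ y
      ...   | yes x≡y = x≡y
      ...   | no  x≢y = contradiction
        (five-cycle (≢-sym v≢a) (≢-sym x≢a) (≢-sym x≢y) y≢b v≢b ay yv (flip-adj xv) (flip-adj bx) (flip-adj ab)) no-C5

      -- An `outer` vertex has at most one neighbour in the first neighbourhood, so the sum is at
      -- most 1, and if it is 1 the vertex is at distance 2 from the edge. Any other vertex is
      -- counted once by its zone.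
      covered : ∀ v → [a] (zone v) + [b] (zone v) + ℓ v + ∑[ x < n ] (f x v * ω v) ≤ ball v
      covered v = subst (λ t → [a] (zone v) + [b] (zone v) + ℓ v + t ≤ ball v) (*-distribʳ-sum (ω v) (λ x → f x v)) (go (zone v))
        where
        S : ℕ
        S = ∑[ x < n ] f x v

        near : 1 ≤ ball v → 1 + S * 0 ≤ ball v
        near = subst (λ t → 1 + t ≤ ball v) (sym (*-zeroʳ S))

        f-≤1 : ∀ x → f x v ≤ 1
        f-≤1 x = *-mono-≤ ([ℓ]-≤1 (zone x)) (A-≤1 x v)

        go : (z : Zone v) → [a] z + [b] z + [ℓ] z + S * [ω] z ≤ ball v
        go (at-a refl)      = near (ball-pos v 0 (inj₁ here) z≤n)
        go (at-b refl)      = near (ball-pos v 0 (inj₂ here) z≤n)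
        go (only-a av _ _)  = near (ball-pos v 1 (inj₁ (step av here)) (s≤s z≤n))
        go (only-b _ bv _)  = near (ball-pos v 1 (inj₂ (step bv here)) (s≤s z≤n))
        go (common av _)    = near (ball-pos v 1 (inj₁ (step av here)) (s≤s z≤n))
        go (outer _ _ v≢a v≢b) = subst (_≤ ball v) (sym (*-identityʳ S)) bound
          where
          bound : S ≤ ball v
          bound with Fin.any? (λ x → 1 ≤? f x v)
          ... | no  none = ≤-trans (≤-reflexive (sum-zero λ x → n<1⇒n≡0 (≰⇒> λ pos → none (x , pos)))) z≤n
          ... | yes (x , pos) = ≤-trans (sum-≤1 _ f-≤1 (inner-neighbour-unique v≢a v≢b)) reached
            where
            reached : 1 ≤ ball v
            reached with f-pos {x} {v} pos
            ... | (_ , inj₁ ax) , xv = ball-pos v 2 (inj₁ (step ax (step xv here))) ≤-refl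
            ... | (_ , inj₂ bx) , xv = ball-pos v 2 (inj₂ (step bx (step xv here))) ≤-refl

      -- The edges from the first neighbourhood to `outer`. As no `outer` vertex receives two of
      -- them, this is also the number of vertices at distance 2 from `ab`.
      outgoing : ℕ
      outgoing = ∑[ x < n ] ∑[ v < n ] (f x v * ω v)

      ball-≥ : 2 + (p + q + c) + outgoing ≤ sum ball
      ball-≥ = begin
        2 + (p + q + c) + outgoing
          ≡⟨ cong₂ _+_ (cong₂ _+_ (sym (cong₂ _+_ sum-[a] sum-[b])) (sym (sum-+₃ α β γ))) (∑-comm {n} {n} _) ⟩
        sum (λ v → [a] (zone v)) + sum (λ v → [b] (zone v)) + sum ℓ + sum (λ v → ∑[ x < n ] (f x v * ω v))
          ≡⟨ sum-+₄ (λ v → [a] (zone v)) _ ℓ _ ⟨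
        sum (λ v → [a] (zone v) + [b] (zone v) + ℓ v + ∑[ x < n ] (f x v * ω v))
          ≤⟨ sum-mono covered ⟩
        sum ball ∎
        where open ≤-Reasoning

      -- The neighbours of `x` are sorted by zone; the factor `ℓ x` makes the claim trivial outside
      -- the first neighbourhood.
      ℓ-degrees : ∀ x → (2 + e) * ℓ x ≤
                  α x + β x + 2 * γ x + ∑[ v < n ] (α x * A x v * α v) + ∑[ v < n ] (β x * A x v * β v) + ∑[ v < n ] (f x v * ω v)
      ℓ-degrees x = begin
        (2 + e) * ℓ x
          ≤⟨ *-monoˡ-≤ (ℓ x) (min-degree x) ⟩
        degree G x * ℓ x
          ≡⟨ trans (*-comm (degree G x) (ℓ x)) (trans (cong (ℓ x *_) (degree≡sum x)) (*-distribˡ-sum (ℓ x) (A x))) ⟩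
        sum (f x)
          ≡⟨ sum-cong-≗ (λ v → trans (sym (*-identityʳ (f x v)))
               (trans (cong (f x v *_) (sym (partition (zone v)))) (distrib (f x v) _ _ _ _))) ⟩
        sum (λ v → f x v * [a] (zone v) + f x v * [b] (zone v) + f x v * ℓ v + f x v * ω v)
          ≡⟨ sum-+₄ (λ v → f x v * [a] (zone v)) _ _ _ ⟩
        sum (λ v → f x v * [a] (zone v)) + sum (λ v → f x v * [b] (zone v)) + sum (λ v → f x v * ℓ v) + sum (λ v → f x v * ω v)
          ≡⟨ cong₂ (λ s t → s + t + sum (λ v → f x v * ℓ v) + sum (λ v → f x v * ω v)) (sum-*[a] (f x)) (sum-*[b] (f x)) ⟩
        f x a + f x b + sum (λ v → f x v * ℓ v) + sum (λ v → f x v * ω v)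
          ≤⟨ +-monoˡ-≤ _ (+-mono-≤ (to-centres x) (sum-mono (inside x))) ⟩
        α x + β x + 2 * γ x + sum (λ v → α x * A x v * α v + β x * A x v * β v) + sum (λ v → f x v * ω v)
          ≡⟨ cong (_+ sum (λ v → f x v * ω v))
               (trans (cong (α x + β x + 2 * γ x +_) (∑-distrib-+ (λ v → α x * A x v * α v) _))
                      (sym (+-assoc (α x + β x + 2 * γ x) _ _))) ⟩
        α x + β x + 2 * γ x + sum (λ v → α x * A x v * α v) + sum (λ v → β x * A x v * β v) + sum (λ v → f x v * ω v)
          ∎
        where
        open ≤-Reasoning
        distrib : ∀ k r s t u → k * (r + s + t + u) ≡ k * r + k * s + k * t + k * u
        distrib = solve-∀

      outgoing-≥ : (2 + e) * (p + q + c) ≤ p + q + 2 * c + A-side.inner + B-side.inner + outgoing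
      outgoing-≥ = begin
        (2 + e) * (p + q + c)             ≡⟨ cong ((2 + e) *_) (sum-+₃ α β γ) ⟨
        (2 + e) * sum ℓ                   ≡⟨ *-distribˡ-sum (2 + e) ℓ ⟩
        sum (λ x → (2 + e) * ℓ x)         ≤⟨ sum-mono ℓ-degrees ⟩
        _                                 ≡⟨ sum-+₄ (λ x → α x + β x + 2 * γ x) _ _ _ ⟩
        sum (λ x → α x + β x + 2 * γ x) + A-side.inner + B-side.inner + outgoing
          ≡⟨ cong (λ t → t + A-side.inner + B-side.inner + outgoing) (trans (sum-+₃ α β _) (cong (p + q +_) (sym (*-distribˡ-sum 2 γ)))) ⟩
        p + q + 2 * c + A-side.inner + B-side.inner + outgoing ∎
        where open ≤-Reasoning

      -- When `outgoing-≥` is inserted into `ball-≥`, the terms `p + q` cancel. Each side is left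
      -- with its degree sum less its inner edges, for which `w` is a lower bound.
      ball-≥-sides : ∀ w → A-side.inner + w ≤ (2 + e) * p → B-side.inner + w ≤ (2 + e) * q →
                     2 * w + (2 + e) * c + 2 ≤ sum ball + c
      ball-≥-sides w w≤p w≤q =
        linear (+-mono-≤ (+-mono-≤ (+-mono-≤ w≤p w≤q) outgoing-≥) ball-≥)
          (balance e p q c w A-side.inner B-side.inner outgoing (sum ball))
        where
        balance : ∀ e p q c w i j o t →
          2 * w + (2 + e) * c + 2 + ((2 + e) * p + (2 + e) * q + (p + q + 2 * c + i + j + o) + t) ≡
          t + c + (i + w + (j + w) + (2 + e) * (p + q + c) + (2 + (p + q + c) + o))
        balance = solve-∀

      -- Both sides have at least `1 + e` vertices. The resulting bound exceeds the target by
      -- `e + 1 − 2 * oddness e`, which is not negative because `1 ≤ e`, that is, `δ ≥ 3`.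
      no-common : c ≡ 0 → 2 * e * e + 3 * e + 3 + 2 * oddness e ≤ sum ball
      no-common c≡0 = linear
        (+-mono-≤ (ball-≥-sides ((1 + e) * (1 + e))
                    (A-side.inner-bound-large (enough degree-a)) (B-side.inner-bound-large (enough degree-b)))
                  (+-mono-≤ (≤-trans (oddness-≤1 e) 1≤e) (oddness-≤1 e)))
        (trans (cong (λ c → 2 * e * e + 3 * e + 3 + 2 * oddness e + (sum ball + c + (e + 1))) c≡0)
          (trans (balance e (oddness e) (sum ball))
            (cong (λ c → sum ball + (2 * ((1 + e) * (1 + e)) + (2 + e) * c + 2 + (oddness e + oddness e))) (sym c≡0))))
        where
        enough : ∀ {k} → 1 + e ≤ k + c → 1 + e ≤ k
        enough {k} = subst (1 + e ≤_) (trans (cong (k +_) c≡0) (+-identityʳ k))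

        balance : ∀ e o t → 2 * e * e + 3 * e + 3 + 2 * o + (t + 0 + (e + 1)) ≡
                            t + (2 * ((1 + e) * (1 + e)) + (2 + e) * 0 + 2 + (o + o))
        balance = solve-∀

      -- The extremal case: each side is only known to have `e` vertices, and the bound obtained is
      -- exactly the value of `δ°`.
      one-common : c ≡ 1 → 2 * e * e + 3 * e + 3 + 2 * oddness e ≤ sum ball
      one-common c≡1 = linear
        (ball-≥-sides ((1 + e) * e + oddness e)
          (bound A-side.inner A-side.inner-bound degree-a) (bound B-side.inner B-side.inner-bound degree-b))
        (trans (cong (λ c → 2 * e * e + 3 * e + 3 + 2 * oddness e + (sum ball + c)) c≡1)
          (trans (balance e (oddness e) (sum ball))
            (cong (λ c → sum ball + (2 * ((1 + e) * e + oddness e) + (2 + e) * c + 2)) (sym c≡1))))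
        where
        bound : ∀ i {k m} → (e ≤ k → i + (1 + e) * e + oddness e ≤ m) → 1 + e ≤ k + c → i + ((1 + e) * e + oddness e) ≤ m
        bound i {k} {m} inner-bound deg = subst (_≤ m) (+-assoc i _ _)
          (inner-bound (s≤s⁻¹ (subst (1 + e ≤_) (trans (cong (k +_) c≡1) (+-comm k 1)) deg)))

        balance : ∀ e o t → 2 * e * e + 3 * e + 3 + 2 * o + (t + 1) ≡
                            t + (2 * ((1 + e) * e + o) + (2 + e) * 1 + 2)
        balance = solve-∀

      ball-size : δ° (2 + e) ≤ sum ball
      ball-size = ≤-trans (≤-reflexive (δ°-value e)) (by-cases (m≤n⇒m<n∨m≡n c≤1))
        where
        by-cases : c < 1 ⊎ c ≡ 1 → 2 * e * e + 3 * e + 3 + 2 * oddness e ≤ sum ball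
        by-cases (inj₁ c<1) = no-common (n<1⇒n≡0 c<1)
        by-cases (inj₂ c≡1) = one-common c≡1

-- Packings of edges

module _ {n} (G : Graph n) where

  infixr 5 _++ʷ_
  _++ʷ_ : ∀ {u v w k l} → Walk G u v k → Walk G v w l → Walk G u w (k + l)
  here      ++ʷ q = q
  step uv p ++ʷ q = step uv (p ++ʷ q)

  reverse : ∀ {u v k} → Walk G u v k → Walk G v u k
  reverse here = here
  reverse {u} {w} {suc k} (step uv p) =
    subst (Walk G w u) (+-comm k 1) (reverse p ++ʷ step (flip-adj G uv) here)

  -- The last edge before the walk first enters `P`. With `P` being remoteness from a packing, this
  -- edge is the next one to be packed.
  crossing : ∀ {P : Fin n → Set} → (∀ v → Dec (P v)) → ∀ {u v k} → Walk G u v k → ¬ P u → P v →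
             ∃[ x ] ∃[ y ] Adj G x y × ¬ P x × P y
  crossing P? here ¬Pu Pu = contradiction Pu ¬Pu
  crossing P? (step {u} {v} uv p) ¬Pu Pw with P? v
  ... | yes Pv = u , v , uv , ¬Pu , Pv
  ... | no ¬Pv = crossing P? p ¬Pv Pw

  neighbour : ∀ {v} → 1 ≤ degree G v → ∃[ w ] Adj G v w
  neighbour {v} pos with Fin.any? (λ w → 1 ≤? A G v w)
  ... | yes (w , 1≤A) = w , A-adj G 1≤A
  ... | no  none = contradiction
    (subst (1 ≤_) (trans (degree≡sum G v) (sum-zero λ w → n<1⇒n≡0 (≰⇒> λ 1≤A → none (w , 1≤A)))) pos) λ ()

  module Packings (d : Fin n → Fin n → ℕ) (isDist : ∀ u v → IsDist G u v (d u v)) where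

    d-walk : ∀ u v → Walk G u v (d u v)
    d-walk u v = proj₁ (isDist u v)

    d-≤ : ∀ {u v k} → Walk G u v k → d u v ≤ k
    d-≤ {u} {v} {k} = proj₂ (isDist u v) k

    d-triangle : ∀ u v w → d u w ≤ d u v + d v w
    d-triangle u v w = d-≤ (d-walk u v ++ʷ d-walk v w)

    d-sym : ∀ u v → d u v ≡ d v u
    d-sym u v = ≤-antisym (d-≤ (reverse (d-walk v u))) (d-≤ (reverse (d-walk u v)))

    d-chain : ∀ u v w x → d u x ≤ d u v + d v w + d w x
    d-chain u v w x = ≤-trans (d-triangle u w x) (+-monoˡ-≤ (d w x) (d-triangle u v w))

    ends-close : ∀ (e : Fin 2 → Fin n) → Adj G (e 0F) (e 1F) → ∀ s t → d (e s) (e t) ≤ 1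
    ends-close e edge 0F 0F = ≤-trans (d-≤ here) z≤n
    ends-close e edge 0F 1F = d-≤ (step edge here)
    ends-close e edge 1F 0F = d-≤ (step (flip-adj G edge) here)
    ends-close e edge 1F 1F = ≤-trans (d-≤ here) z≤n

    ends-of : Fin n → Fin n → Fin 2 → Fin n
    ends-of x y 0F = x
    ends-of x y 1F = y

    -- The edges ends i are pairwise at distance at least 5, and neighbours in the tree are at distance at most 5;
    -- a step of the tree costs 6 because the path may have to cross an edge of the packing.
    record Packing (m : ℕ) : Set where
      field
        ends : Fin m → Fin 2 → Fin n
        edge : ∀ i → Adj G (ends i 0F) (ends i 1F)
        far  : ∀ i j → i ≢ j → ∀ s t → 5 ≤ d (ends i s) (ends j t)
        tree : Tree m
        near : ∀ i j s t → d (ends i s) (ends j t) ≤ 1 + 6 * ρ tree i j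

      ball : Fin m → Fin n → ℕ
      ball i v = indicator (Fin.any? λ s → d (ends i s) v ≤? 2)

      ball-near : ∀ i v → 1 ≤ ball i v → ∃[ s ] d (ends i s) v ≤ 2
      ball-near i v = indicator-pos (Fin.any? λ s → d (ends i s) v ≤? 2)

      near-ball : ∀ i v s → d (ends i s) v ≤ 2 → 1 ≤ ball i v
      near-ball i v s d≤2 = ≤-reflexive (sym (indicator-yes (Fin.any? λ s → d (ends i s) v ≤? 2) (s , d≤2)))

      ball-≤1 : ∀ i v → ball i v ≤ 1
      ball-≤1 i v = indicator-≤1 (Fin.any? λ s → d (ends i s) v ≤? 2)

      -- A shared vertex would bring the two edges within 2 + 2 < 5 of each other.
      ball-disjoint : ∀ v i j → 1 ≤ ball i v → 1 ≤ ball j v → i ≡ j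
      ball-disjoint v i j pi pj with i Fin.≟ j | ball-near i v pi | ball-near j v pj
      ... | yes i≡j | _ | _ = i≡j
      ... | no  i≢j | s , dᵢ≤2 | t , dⱼ≤2 = contradiction (far i j i≢j s t) (<⇒≱ (s≤s (begin
        d (ends i s) (ends j t)           ≤⟨ d-triangle (ends i s) v (ends j t) ⟩
        d (ends i s) v + d v (ends j t)   ≤⟨ +-mono-≤ dᵢ≤2 (subst (_≤ 2) (d-sym (ends j t) v) dⱼ≤2) ⟩
        4                                 ∎)))
        where open ≤-Reasoning

    single : ∀ {x y} → Adj G x y → Packing 1
    single {x} {y} xy = record
      { ends = λ _ → ends-of x y
      ; edge = λ _ → xy
      ; far  = λ { 0F 0F 0≢0 → contradiction refl 0≢0 }
      ; tree = root
      ; near = λ _ _ → ends-close (ends-of x y) xy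
      }

    module _ {m} (P : Packing m) where
      open Packing P

      -- The threshold is 6 rather than 5 so that any neighbour of a remote vertex is still at
      -- distance at least 5 and can be the other end of a new edge.
      Remote : Fin n → Set
      Remote v = ∀ i s → 6 ≤ d (ends i s) v

      remote? : ∀ v → Dec (Remote v)
      remote? v = Fin.all? (λ i → Fin.all? (λ s → 6 ≤? d (ends i s) v))

      ¬remote : ∀ v → ¬ Remote v → ∃[ i ] ∃[ s ] d (ends i s) v ≤ 5
      ¬remote v ¬r =
        let i , ¬rᵢ = Fin.¬∀⟶∃¬ _ _ (λ i → Fin.all? (λ s → 6 ≤? d (ends i s) v)) ¬r
            s , ¬rₛ = Fin.¬∀⟶∃¬ _ _ (λ s → 6 ≤? d (ends i s) v) ¬rᵢ
        in i , s , s≤s⁻¹ (≰⇒> ¬rₛ)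

      -- On a walk from the packing to `v` let `y` be the first remote vertex and `x` its
      -- predecessor. Then `x` is within 5 of an edge `p`, which becomes the parent of the new leaf
      -- `xy`; the vertex `v` itself need not lie on the new edge.
      extend : ∀ v → Remote v → Packing (suc m)
      extend v remote-v with crossing remote? (d-walk (ends (tree-node tree) 0F) v) start remote-v
        where
        start : ¬ Remote (ends (tree-node tree) 0F)
        start remote = contradiction (≤-trans (remote (tree-node tree) 0F) (d-≤ here)) λ ()
      ... | x , y , xy , ¬remote-x , remote-y with ¬remote x ¬remote-x
      ... | p , s₀ , d≤5 = record { ends = ends′ ; edge = edge′ ; far = far′ ; tree = grow tree p ; near = near′ }
        where
        ends′ : Fin (suc m) → Fin 2 → Fin n
        ends′ zero    = ends-of x y
        ends′ (suc i) = ends i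

        edge′ : ∀ i → Adj G (ends′ i 0F) (ends′ i 1F)
        edge′ zero    = xy
        edge′ (suc i) = edge i

        far-new : ∀ i s t → 5 ≤ d (ends i s) (ends-of x y t)
        far-new i s 0F = s≤s⁻¹ (begin
          6                        ≤⟨ remote-y i s ⟩
          d (ends i s) y           ≤⟨ d-triangle (ends i s) x y ⟩
          d (ends i s) x + d x y   ≤⟨ +-monoʳ-≤ _ (d-≤ (step xy here)) ⟩
          d (ends i s) x + 1       ≡⟨ +-comm _ 1 ⟩
          suc (d (ends i s) x)     ∎)
          where open ≤-Reasoning
        far-new i s 1F = <⇒≤ (remote-y i s)

        far′ : ∀ i j → i ≢ j → ∀ s t → 5 ≤ d (ends′ i s) (ends′ j t)
        far′ zero    zero    0≢0 s t = contradiction refl 0≢0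
        far′ zero    (suc j) _   s t = subst (5 ≤_) (d-sym (ends j t) _) (far-new j t s)
        far′ (suc i) zero    _   s t = far-new i s t
        far′ (suc i) (suc j) i≢j s t = far i j (i≢j ∘ cong suc) s t

        near-new : ∀ i s t → d (ends i s) (ends-of x y t) ≤ 1 + 6 * suc (ρ tree i p)
        near-new i s t = begin
          d (ends i s) (ends-of x y t)
            ≤⟨ d-chain (ends i s) (ends p s₀) x (ends-of x y t) ⟩
          d (ends i s) (ends p s₀) + d (ends p s₀) x + d x (ends-of x y t)
            ≤⟨ +-mono-≤ (+-mono-≤ (near i p s s₀) d≤5) (ends-close (ends-of x y) xy 0F t) ⟩
          1 + 6 * ρ tree i p + 5 + 1
            ≡⟨ regroup (ρ tree i p) ⟩
          1 + 6 * suc (ρ tree i p) ∎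
          where
          open ≤-Reasoning
          regroup : ∀ k → 1 + 6 * k + 5 + 1 ≡ 1 + 6 * suc k
          regroup = solve-∀

        near′ : ∀ i j s t → d (ends′ i s) (ends′ j t) ≤ 1 + 6 * ρ (grow tree p) i j
        near′ zero    zero    s t = ends-close (ends-of x y) xy s t
        near′ zero    (suc j) s t = subst₂ _≤_ (d-sym (ends j t) _) (cong (λ k → 1 + 6 * suc k) (ρ-sym tree j p)) (near-new j t s)
        near′ (suc i) zero    s t = near-new i s t
        near′ (suc i) (suc j) s t = near i j s t

    record Covering : Set where
      field
        {size}  : ℕ
        packing : Packing size
      open Packing packing public
      field
        covers  : ∀ v → ∃[ i ] ∃[ s ] d (ends i s) v ≤ 5

    -- Maximal packings and the sum of the eccentricities.

    module _ (D : ℕ) (1≤D : 1 ≤ D)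
             (ball-size : ∀ {m} (P : Packing m) i → D ≤ ∑[ v < n ] Packing.ball P i v) where

      packing-size : ∀ {m} → Packing m → m * D ≤ n
      packing-size {m} P = begin
        m * D                                 ≡⟨ sum-const m D ⟨
        sum {m} (λ _ → D)                     ≤⟨ sum-mono (ball-size P) ⟩
        ∑[ i < m ] ∑[ v < n ] ball i v        ≡⟨ ∑-comm {m} {n} ball ⟩
        ∑[ v < n ] ∑[ i < m ] ball i v        ≤⟨ sum-mono (λ v → sum-≤1 (λ i → ball i v) (λ i → ball-≤1 i v) (ball-disjoint v)) ⟩
        sum {n} (λ _ → 1)                     ≡⟨ trans (sum-const n 1) (*-identityʳ n) ⟩
        n                                     ∎
        where
        open ≤-Reasoning
        open Packing P

      -- Every extension trades one unit of fuel for one edge. As `m ≤ m * D ≤ n` for every packing,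
      -- the fuel cannot run out before all vertices are covered.
      saturate : ∀ {m} fuel → n < m + fuel → Packing m → Covering
      saturate {m} zero n<m P = contradiction n<m (≤⇒≯ (begin
        m + 0   ≡⟨ +-identityʳ m ⟩
        m       ≡⟨ *-identityʳ m ⟨
        m * 1   ≤⟨ *-monoʳ-≤ m 1≤D ⟩
        m * D   ≤⟨ packing-size P ⟩
        n       ∎))
        where open ≤-Reasoning
      saturate {m} (suc fuel) n<m+fuel P with Fin.any? (remote? P)
      ... | yes (v , remote) = saturate fuel (subst (n <_) (+-suc m fuel) n<m+fuel) (extend P v remote)
      ... | no  none = record { packing = P ; covers = λ v → ¬remote P v (λ remote → none (v , remote)) }

      module _ (cov : Covering) (ecc : Fin n → ℕ) (isEcc : ∀ v → IsEcc G v (ecc v)) where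
        open Covering cov
        open Centre (find-centre tree) using () renaming (centre to c; radius to r; reach to reach)
        open CentreProperties tree (find-centre tree)

        -- The route leads from `v` to the edge `i`, along the packing to an edge `j` within 5 of
        -- `w`, and on to `w`; in the tree it is estimated through the centre. The bound is used
        -- with `a = 2` on balls and `a = 5` in general.
        distance-≤ : ∀ {i s v w a} → d (ends i s) v ≤ a → d v w ≤ a + (1 + 6 * (depth i + r)) + 5
        distance-≤ {i} {s} {v} {w} {a} dᵢ≤a with covers w
        ... | j , t , dⱼ≤5 = begin
          d v w
            ≤⟨ d-chain v (ends i s) (ends j t) w ⟩
          d v (ends i s) + d (ends i s) (ends j t) + d (ends j t) w
            ≤⟨ +-mono-≤ (+-mono-≤ (subst (_≤ a) (d-sym (ends i s) v) dᵢ≤a) (near i j s t)) dⱼ≤5 ⟩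
          a + (1 + 6 * ρ tree i j) + 5
            ≤⟨ +-monoˡ-≤ 5 (+-monoʳ-≤ a (+-monoʳ-≤ 1 (*-monoʳ-≤ 6 via-centre))) ⟩
          a + (1 + 6 * (depth i + r)) + 5 ∎
          where
          open ≤-Reasoning
          via-centre : ρ tree i j ≤ depth i + r
          via-centre = ≤-trans (ρ-triangle tree i c j) (+-mono-≤ (≤-reflexive (ρ-sym tree i c)) (reach j))

        ecc-≤ : ∀ {i s v a} → d (ends i s) v ≤ a → ecc v ≤ a + (1 + 6 * (depth i + r)) + 5
        ecc-≤ {v = v} dᵢ≤a =
          let w , _ , ecc-minimal = proj₂ (isEcc v) in ≤-trans (ecc-minimal _ (d-walk v w)) (distance-≤ dᵢ≤a)

        -- As balls are disjoint, at most one term of the sum survives. In the ball of `i` the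
        -- saving cancels `depth i` and the gain of 3; outside all balls `depth i ≤ r` gives
        -- `5 + (1 + 12 * r) + 5`.
        ecc+saving-≤ : ∀ v → ecc v + ∑[ i < size ] (ball i v * saving i) ≤ 12 * r + 11
        ecc+saving-≤ v with Fin.any? (λ i → 1 ≤? ball i v)
        ... | yes (i , pos) = begin
          ecc v + sum (λ j → ball j v * saving j)
            ≡⟨ cong (ecc v +_) (sum-support i off) ⟩
          ecc v + ball i v * saving i
            ≤⟨ +-mono-≤ (ecc-≤ (proj₂ (ball-near i v pos))) (≤-trans (*-monoˡ-≤ (saving i) (ball-≤1 i v)) (≤-reflexive (*-identityˡ _))) ⟩
          2 + (1 + 6 * (depth i + r)) + 5 + (6 * (r ∸ depth i) + 3)
            ≡⟨ regroup (depth i) r (r ∸ depth i) ⟩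
          6 * (depth i + (r ∸ depth i)) + 6 * r + 11
            ≡⟨ cong (λ k → 6 * k + 6 * r + 11) (m+[n∸m]≡n (reach i)) ⟩
          6 * r + 6 * r + 11
            ≡⟨ double r ⟩
          12 * r + 11 ∎
          where
          open ≤-Reasoning
          off : ∀ j → j ≢ i → ball j v * saving j ≡ 0
          off j j≢i = cong (_* saving j) (n<1⇒n≡0 (≰⇒> λ posⱼ → j≢i (ball-disjoint v j i posⱼ pos)))

          regroup : ∀ k r l → 2 + (1 + 6 * (k + r)) + 5 + (6 * l + 3) ≡ 6 * (k + l) + 6 * r + 11
          regroup = solve-∀

          double : ∀ r → 6 * r + 6 * r + 11 ≡ 12 * r + 11
          double = solve-∀
        ... | no none with covers v
        ... | i , s , dᵢ≤5 = begin
          ecc v + sum (λ j → ball j v * saving j)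
            ≡⟨ trans (cong (ecc v +_) (sum-zero λ j → cong (_* saving j) (n<1⇒n≡0 (≰⇒> λ pos → none (j , pos))))) (+-identityʳ _) ⟩
          ecc v
            ≤⟨ ecc-≤ dᵢ≤5 ⟩
          5 + (1 + 6 * (depth i + r)) + 5
            ≤⟨ +-monoˡ-≤ 5 (+-monoʳ-≤ 6 (*-monoʳ-≤ 6 (+-monoˡ-≤ r (reach i)))) ⟩
          5 + (1 + 6 * (r + r)) + 5
            ≡⟨ regroup r ⟩
          12 * r + 11 ∎
          where
          open ≤-Reasoning
          regroup : ∀ r → 5 + (1 + 6 * (r + r)) + 5 ≡ 12 * r + 11
          regroup = solve-∀

        -- After exchanging the sums, the saving of each node is counted once for every vertex of
        -- its ball, hence at least `D` times.
        ecc-sum-≤ : sum ecc + D * (6 * r * r + 6 * r) ≤ n * (12 * r + 11)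
        ecc-sum-≤ = begin
          sum ecc + D * (6 * r * r + 6 * r)
            ≤⟨ +-monoʳ-≤ (sum ecc) (*-monoʳ-≤ D saving-sum-≥) ⟩
          sum ecc + D * sum saving
            ≡⟨ cong (sum ecc +_) (*-distribˡ-sum D saving) ⟩
          sum ecc + sum (λ i → D * saving i)
            ≤⟨ +-monoʳ-≤ (sum ecc) (sum-mono λ i → *-monoˡ-≤ (saving i) (ball-size packing i)) ⟩
          sum ecc + sum (λ i → sum (ball i) * saving i)
            ≡⟨ cong (sum ecc +_) (trans (sum-cong-≗ λ i → *-distribʳ-sum (saving i) (ball i)) (∑-comm {size} {n} _)) ⟩
          sum ecc + sum (λ v → ∑[ i < size ] (ball i v * saving i))
            ≡⟨ ∑-distrib-+ ecc _ ⟨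
          sum (λ v → ecc v + ∑[ i < size ] (ball i v * saving i))
            ≤⟨ sum-mono ecc+saving-≤ ⟩
          sum {n} (λ _ → 12 * r + 11)
            ≡⟨ sum-const n _ ⟩
          n * (12 * r + 11) ∎
          where open ≤-Reasoning

        2*radius*D≤n : 2 * r * D ≤ n
        2*radius*D≤n = ≤-trans (*-monoˡ-≤ D 2*radius≤order) (packing-size packing)

-- Arithmetic of the final bound.

-- The difference of the two sides is 12 r j + 9 j² − 6 j for k = 2 r + j.
radius-quadratic : ∀ {k r} → 2 * r ≤ k → k * (24 * r + 6) ≤ 9 * k * k + (12 * r * r + 12 * r)
radius-quadratic {k} {r} 2r≤k with m≤n⇒∃[o]m+o≡n 2r≤k
... | zero  , refl = ≤-reflexive (expand r)
  where
  expand : ∀ r → (2 * r + 0) * (24 * r + 6) ≡ 9 * (2 * r + 0) * (2 * r + 0) + (12 * r * r + 12 * r)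
  expand = solve-∀
-- With `suc j` for `j` the part `9 j² − 6 j` becomes `9 j² + 12 j + 3`, free of subtraction.
... | suc j , refl = m+n≤o⇒m≤o _ {12 * r * suc j + 9 * j * j + 12 * j + 3} (≤-reflexive (expand r j))
  where
  expand : ∀ r j → (2 * r + suc j) * (24 * r + 6) + (12 * r * suc j + 9 * j * j + 12 * j + 3) ≡
                   9 * (2 * r + suc j) * (2 * r + suc j) + (12 * r * r + 12 * r)
  expand = solve-∀

-- In dividing `n + k` by `suc k` the remainder is at most `k`.
n≤⌈n/suc⌉*suc : ∀ n k → n ≤ ⌈ n /suc k ⌉ * suc k
n≤⌈n/suc⌉*suc n k = linear (s≤s⁻¹ (m%n<n (n + k) (suc k)))
  (trans (m≡m%n+[m/n]*n (n + k) (suc k)) (+-comm _ (⌈ n /suc k ⌉ * suc k)))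

average-bound : ∀ {n D k r S} → .{{NonZero D}} → n ≤ k * D → 2 * r * D ≤ n →
                S + D * (6 * r * r + 6 * r) ≤ n * (12 * r + 11) → 2 * S ≤ n * (9 * k + 16)
average-bound {n} {D} {k} {r} {S} n≤kD 2rD≤n bound with ≤-total (24 * r + 6) (9 * k)
... | inj₁ small = begin
  2 * S                        ≤⟨ *-monoʳ-≤ 2 (m+n≤o⇒m≤o S bound) ⟩
  2 * (n * (12 * r + 11))      ≡⟨ regroup n r ⟩
  n * (24 * r + 6 + 16)        ≤⟨ *-monoʳ-≤ n (+-monoˡ-≤ 16 small) ⟩
  n * (9 * k + 16)             ∎
  where
  open ≤-Reasoning
  regroup : ∀ n r → 2 * (n * (12 * r + 11)) ≡ n * (24 * r + 6 + 16)
  regroup = solve-∀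
... | inj₂ large with m≤n⇒∃[o]m+o≡n large
... | t , 9k+t≡ = +-cancelʳ-≤ (D * Q) (2 * S) (n * (9 * k + 16)) (begin
  2 * S + D * Q                              ≡⟨ double S D r ⟩
  2 * (S + D * (6 * r * r + 6 * r))          ≤⟨ *-monoʳ-≤ 2 bound ⟩
  2 * (n * (12 * r + 11))                    ≡⟨ expand n r ⟩
  n * (24 * r + 6) + n * 16                  ≡⟨ cong (λ m → n * m + n * 16) 9k+t≡ ⟨
  n * (9 * k + t) + n * 16                   ≡⟨ regroup n k t ⟩
  n * (9 * k + 16) + n * t                   ≤⟨ +-monoʳ-≤ (n * (9 * k + 16)) nt≤DQ ⟩
  n * (9 * k + 16) + D * Q                   ∎)
  where
  open ≤-Reasoning
  Q : ℕ
  Q = 12 * r * r + 12 * r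

  double : ∀ S D r → 2 * S + D * (12 * r * r + 12 * r) ≡ 2 * (S + D * (6 * r * r + 6 * r))
  double = solve-∀

  expand : ∀ n r → 2 * (n * (12 * r + 11)) ≡ n * (24 * r + 6) + n * 16
  expand = solve-∀

  regroup : ∀ n k t → n * (9 * k + t) + n * 16 ≡ n * (9 * k + 16) + n * t
  regroup = solve-∀

  distrib : ∀ k t → 9 * k * k + k * t ≡ k * (9 * k + t)
  distrib = solve-∀

  swap : ∀ k D t → k * D * t ≡ D * (k * t)
  swap = solve-∀

  kt≤Q : k * t ≤ Q
  kt≤Q = +-cancelˡ-≤ (9 * k * k) (k * t) Q (begin
    9 * k * k + k * t      ≡⟨ distrib k t ⟩
    k * (9 * k + t)        ≡⟨ cong (k *_) 9k+t≡ ⟩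
    k * (24 * r + 6)       ≤⟨ radius-quadratic {k} {r} (*-cancelʳ-≤ (2 * r) k D (≤-trans 2rD≤n n≤kD)) ⟩
    9 * k * k + Q          ∎)

  nt≤DQ : n * t ≤ D * Q
  nt≤DQ = begin
    n * t          ≤⟨ *-monoˡ-≤ t n≤kD ⟩
    k * D * t      ≡⟨ swap k D t ⟩
    D * (k * t)    ≤⟨ *-monoʳ-≤ D kt≤Q ⟩
    D * Q          ∎

theorem4 : (n : ℕ) (G : Graph n) (δ : ℕ) → Connected G → IsMinDegree G δ → 3 ≤ δ →
    ¬ HasCycle G 4 → ¬ HasCycle G 5 →
    (ecc : Fin n → ℕ) → (∀ v → IsEcc G v (ecc v)) →
    2 * Σv ecc ≤ n * (9 * ⌈ n /suc (δ° δ ∸ 1) ⌉ + 16)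
theorem4 n G (suc (suc e)) _ (δ≤degree , v₀ , _) (s≤s (s≤s 1≤e)) no-C4 no-C5 ecc isEcc =
  subst (λ S → 2 * S ≤ n * (9 * k + 16)) (sym (Σv≡sum ecc))
    (average-bound {n} {D} {k} {radius} {sum ecc} (n≤⌈n/suc⌉*suc n (δ° (2 + e) ∸ 1))
      (2*radius*D≤n D (s≤s z≤n) ball-size covering ecc isEcc)
      (ecc-sum-≤ D (s≤s z≤n) ball-size covering ecc isEcc))
  where
  -- The distance function is read off the eccentricity data, which contain a distance for every
  -- pair.
  open Packings G (λ u v → proj₁ (proj₁ (isEcc u) v)) (λ u v → proj₁ (proj₂ (proj₁ (isEcc u) v)))
  D k : ℕ
  -- This is the divisor in the ceiling, visibly nonzero; it equals `δ°` because `δ°` is positive.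
  D = suc (δ° (2 + e) ∸ 1)
  k = ⌈ n /suc (δ° (2 + e) ∸ 1) ⌉

  D≡δ° : D ≡ δ° (2 + e)
  D≡δ° = m+[n∸m]≡n (δ°-pos e)

  ball-size : ∀ {m} (P : Packing m) i → D ≤ ∑[ v < n ] Packing.ball P i v
  ball-size P i = subst (_≤ sum (ball i)) (sym D≡δ°)
    (EdgeBall.ball-size G no-C4 no-C5 e 1≤e δ≤degree (ends i 0F) (ends i 1F) (edge i) (ball i) contains)
    where
    open Packing P
    contains : ∀ v l → Walk G (ends i 0F) v l ⊎ Walk G (ends i 1F) v l → l ≤ 2 → 1 ≤ ball i v
    contains v l (inj₁ w) l≤2 = near-ball i v 0F (≤-trans (d-≤ w) l≤2)
    contains v l (inj₂ w) l≤2 = near-ball i v 1F (≤-trans (d-≤ w) l≤2)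

  covering : Covering
  -- The search starts from a single edge, so fuel `n` satisfies `n < 1 + n`.
  covering = saturate D (s≤s z≤n) ball-size n ≤-refl
    (single (proj₂ (neighbour G (≤-trans (s≤s z≤n) (δ≤degree v₀)))))

  radius : ℕ
  radius = Centre.radius (find-centre (Covering.tree covering))
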